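{- Let $(\Omega,\leftarrow,\rightarrow,\triangleleft,\triangleright)$ be a finite nonempty nondegenerate extended diassociative semigroup (EDS) such that $\alpha\leftarrow\beta=\alpha$ and $\alpha\rightarrow\beta=\beta$ for all $\alpha,\beta\in\Omega$. Then there exist a group $(H,\star)$, a nonempty set $K$ and a map $\theta:K\to H$ such that $\Omega$ is isomorphic to $\mathbf{EDS}^*(H,\star,K,\theta)$.
   Context: Extended diassociative semigroups. A diassociative semigroup is a set $\Omega$ with maps $\leftarrow,\rightarrow:\Omega\times\Omega\to\Omega$ such that for all $\alpha,\beta,\gamma\in\Omega$: $(\alpha\leftarrow\beta)\leftarrow\gamma=\alpha\leftarrow(\beta\leftarrow\gamma)=\alpha\leftarrow(\beta\rightarrow\gamma)$; $(\alpha\rightarrow\beta)\leftarrow\gamma=\alpha\rightarrow(\beta\leftarrow\gamma)$; $(\alpha\rightarrow\beta)\rightarrow\gamma=(\alpha\leftarrow\beta)\rightarrow\gamma=\alpha\rightarrow(\beta\rightarrow\gamma)$. An extended diassociative semigroup (EDS) is $(\Omega,\leftarrow,\rightarrow,\triangleleft,\triangleright)$ such that $(\Omega,\leftarrow,\rightarrow)$ is a diassociative semigroup and for all $\alpha,\beta,\gamma\in\Omega$: $\alpha\triangleright(\beta\leftarrow\gamma)=\alpha\triangleright\beta$; $(\alpha\rightarrow\beta)\triangleleft\gamma=\beta\triangleleft\gamma$; $(\alpha\triangleleft\beta)\leftarrow((\alpha\leftarrow\beta)\triangleleft\gamma)=\alpha\triangleleft(\beta\leftarrow\gamma)$; $(\alpha\triangleleft\beta)\triangleleft((\alpha\leftarrow\beta)\triangleleft\gamma)=\beta\triangleleft\gamma$;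 $(\alpha\triangleleft\beta)\rightarrow((\alpha\leftarrow\beta)\triangleleft\gamma)=\alpha\triangleleft(\beta\rightarrow\gamma)$; $(\alpha\triangleleft\beta)\triangleright((\alpha\leftarrow\beta)\triangleleft\gamma)=\beta\triangleright\gamma$; $(\alpha\triangleright(\beta\rightarrow\gamma))\leftarrow(\beta\triangleright\gamma)=(\alpha\leftarrow\beta)\triangleright\gamma$; $(\alpha\triangleright(\beta\rightarrow\gamma))\triangleleft(\beta\triangleright\gamma)=\alpha\triangleleft\beta$; $(\alpha\triangleright(\beta\rightarrow\gamma))\rightarrow(\beta\triangleright\gamma)=(\alpha\rightarrow\beta)\triangleright\gamma$; $(\alpha\triangleright(\beta\rightarrow\gamma))\triangleright(\beta\triangleright\gamma)=\alpha\triangleright\beta$. It is nondegenerate if the maps $\varphi_\leftarrow:(\alpha,\beta)\mapsto(\alpha\leftarrow\beta,\alpha\triangleleft\beta)$ and $\varphi_\rightarrow:(\alpha,\beta)\mapsto(\alpha\rightarrow\beta,\alpha\triangleright\beta)$ from $\Omega^2$ to $\Omega^2$ are bijective. An isomorphism of EDS is a bijection compatible with the four operations. For a group $(H,\star)$, a nonempty set $K$ and a map $\theta:K\to H$, $\mathbf{EDS}^*(H,\star,K,\theta)$ is the set $H\times K$ with $(\alpha,\alpha')\leftarrow(\beta,\beta')=(\alpha,\alpha')$, $(\alpha,\alpha')\rightarrow(\beta,\beta')=(\beta,\beta')$, $(\alpha,\alpha')\triangleleft(\beta,\beta')=(\alpha^{ -1}\star\beta,\beta')$, $(\alpha,\alpha')\triangleright(\beta,\beta')=(\theta(\beta')\star\beta^{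 -1}\star\alpha,\alpha')$. -}

module Defs where

open import Algebra.Bundles using (Group)
open import Algebra.Core using (Op₁; Op₂)
open import Algebra.Structures using (IsGroup)
import Algebra.Properties.Group as GroupProperties
open import Data.Fin using (Fin)
open import Data.Nat using (ℕ)
open import Data.Product using (Σ; _×_; _,_)
open import Function.Bundles using (_↔_)
open import Function.Definitions using (Bijective)
open import Level using (Level; suc)
open import Relation.Binary.PropositionalEquality
  using (_≡_; refl; sym; cong; module ≡-Reasoning)

Finite : ∀ {a} → Set a → Set a
Finite A = Σ ℕ λ n → A ↔ Fin n

-- The paper's ← and → are reserved words in Agda; they are written ⟵ and ⟶.

record IsDiassociativeSemigroup {a} {Ω : Set a} (_⟵_ _⟶_ : Op₂ Ω) : Set a where
  field
    ⟵-assoc     : ∀ α β γ → (α ⟵ β) ⟵ γ ≡ α ⟵ (β ⟵ γ)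
    ⟵-absorbs-⟶ : ∀ α β γ → α ⟵ (β ⟵ γ) ≡ α ⟵ (β ⟶ γ)
    ⟶-⟵-assoc   : ∀ α β γ → (α ⟶ β) ⟵ γ ≡ α ⟶ (β ⟵ γ)
    ⟶-absorbs-⟵ : ∀ α β γ → (α ⟶ β) ⟶ γ ≡ (α ⟵ β) ⟶ γ
    ⟵-⟶-assoc   : ∀ α β γ → (α ⟵ β) ⟶ γ ≡ α ⟶ (β ⟶ γ)

record IsEDS {a} {Ω : Set a} (_⟵_ _⟶_ _◁_ _▷_ : Op₂ Ω) : Set a where
  field
    isDiassociativeSemigroup : IsDiassociativeSemigroup _⟵_ _⟶_
    ▷-⟵   : ∀ α β γ → α ▷ (β ⟵ γ) ≡ α ▷ β
    ⟶-◁   : ∀ α β γ → (α ⟶ β) ◁ γ ≡ β ◁ γ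
    ◁-⟵-◁ : ∀ α β γ → (α ◁ β) ⟵ ((α ⟵ β) ◁ γ) ≡ α ◁ (β ⟵ γ)
    ◁-◁-◁ : ∀ α β γ → (α ◁ β) ◁ ((α ⟵ β) ◁ γ) ≡ β ◁ γ
    ◁-⟶-◁ : ∀ α β γ → (α ◁ β) ⟶ ((α ⟵ β) ◁ γ) ≡ α ◁ (β ⟶ γ)
    ◁-▷-◁ : ∀ α β γ → (α ◁ β) ▷ ((α ⟵ β) ◁ γ) ≡ β ▷ γ
    ▷-⟵-▷ : ∀ α β γ → (α ▷ (β ⟶ γ)) ⟵ (β ▷ γ) ≡ (α ⟵ β) ▷ γ
    ▷-◁-▷ : ∀ α β γ → (α ▷ (β ⟶ γ)) ◁ (β ▷ γ) ≡ α ◁ β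
    ▷-⟶-▷ : ∀ α β γ → (α ▷ (β ⟶ γ)) ⟶ (β ▷ γ) ≡ (α ⟶ β) ▷ γ
    ▷-▷-▷ : ∀ α β γ → (α ▷ (β ⟶ γ)) ▷ (β ▷ γ) ≡ α ▷ β

record EDS (a : Level) : Set (suc a) where
  infixl 7 _⟵_ _⟶_ _◁_ _▷_
  field
    Carrier : Set a
    _⟵_     : Op₂ Carrier
    _⟶_     : Op₂ Carrier
    _◁_     : Op₂ Carrier
    _▷_     : Op₂ Carrier
    isEDS   : IsEDS _⟵_ _⟶_ _◁_ _▷_

  open IsEDS isEDS public

module _ {a} (E : EDS a) where
  open EDS E

  φ⟵ : Carrier × Carrier → Carrier × Carrier
  φ⟵ (α , β) = α ⟵ β , α ◁ β

  φ⟶ : Carrier × Carrier → Carrier × Carrier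
  φ⟶ (α , β) = α ⟶ β , α ▷ β

  Nondegenerate : Set a
  Nondegenerate = Bijective _≡_ _≡_ φ⟵ × Bijective _≡_ _≡_ φ⟶

infix 4 _≅_

record _≅_ {a} (E F : EDS a) : Set a where
  private
    module E = EDS E
    module F = EDS F
  field
    to        : E.Carrier → F.Carrier
    bijective : Bijective _≡_ _≡_ to
    ⟵-homo    : ∀ α β → to (α E.⟵ β) ≡ to α F.⟵ to β
    ⟶-homo    : ∀ α β → to (α E.⟶ β) ≡ to α F.⟶ to β
    ◁-homo    : ∀ α β → to (α E.◁ β) ≡ to α F.◁ to β
    ▷-homo    : ∀ α β → to (α E.▷ β) ≡ to α F.▷ to β

module _ {a} {H : Set a} {_★_ : Op₂ H} {ε : H} {_⁻¹ : Op₁ H}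
         (isGroup : IsGroup _≡_ _★_ ε _⁻¹) {K : Set a} (θ : K → H) where

  private
    G : Group a a
    G = record { isGroup = isGroup }

    open Group G using (assoc; inverseˡ; identityˡ)
    open GroupProperties G using (⁻¹-anti-homo-∙)
    open ≡-Reasoning

    cancel : ∀ x α β → ((x ★ α) ⁻¹) ★ (x ★ β) ≡ (α ⁻¹) ★ β
    cancel x α β = begin
      ((x ★ α) ⁻¹) ★ (x ★ β)          ≡⟨ cong (_★ (x ★ β)) (⁻¹-anti-homo-∙ x α) ⟩
      ((α ⁻¹) ★ (x ⁻¹)) ★ (x ★ β)     ≡⟨ assoc (α ⁻¹) (x ⁻¹) (x ★ β) ⟩
      (α ⁻¹) ★ ((x ⁻¹) ★ (x ★ β))     ≡⟨ cong ((α ⁻¹) ★_) (sym (assoc (x ⁻¹) x β)) ⟩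
      (α ⁻¹) ★ (((x ⁻¹) ★ x) ★ β)     ≡⟨ cong (λ y → (α ⁻¹) ★ (y ★ β)) (inverseˡ x) ⟩
      (α ⁻¹) ★ (ε ★ β)                ≡⟨ cong ((α ⁻¹) ★_) (identityˡ β) ⟩
      (α ⁻¹) ★ β                      ∎

    cancel′ : ∀ t x α β → (t ★ ((x ★ α) ⁻¹)) ★ (x ★ β) ≡ (t ★ (α ⁻¹)) ★ β
    cancel′ t x α β = begin
      (t ★ ((x ★ α) ⁻¹)) ★ (x ★ β)    ≡⟨ assoc t ((x ★ α) ⁻¹) (x ★ β) ⟩
      t ★ (((x ★ α) ⁻¹) ★ (x ★ β))    ≡⟨ cong (t ★_) (cancel x α β) ⟩
      t ★ ((α ⁻¹) ★ β)                ≡⟨ sym (assoc t (α ⁻¹) β) ⟩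
      (t ★ (α ⁻¹)) ★ β                ∎

  EDS* : EDS a
  EDS* = record
    { Carrier = H × K
    ; _⟵_ = λ (α , α′) (β , β′) → α , α′
    ; _⟶_ = λ (α , α′) (β , β′) → β , β′
    ; _◁_ = λ (α , α′) (β , β′) → (α ⁻¹) ★ β , β′
    ; _▷_ = λ (α , α′) (β , β′) → (θ β′ ★ (β ⁻¹)) ★ α , α′
    ; isEDS = record
      { isDiassociativeSemigroup = record
        { ⟵-assoc     = λ _ _ _ → refl
        ; ⟵-absorbs-⟶ = λ _ _ _ → refl
        ; ⟶-⟵-assoc   = λ _ _ _ → refl
        ; ⟶-absorbs-⟵ = λ _ _ _ → refl
        ; ⟵-⟶-assoc   = λ _ _ _ → refl
        }
      ; ▷-⟵   = λ _ _ _ → refl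
      ; ⟶-◁   = λ _ _ _ → refl
      ; ◁-⟵-◁ = λ _ _ _ → refl
      ; ◁-◁-◁ = λ (α , _) (β , _) (γ , γ′) → cong (_, γ′) (cancel (α ⁻¹) β γ)
      ; ◁-⟶-◁ = λ _ _ _ → refl
      ; ◁-▷-◁ = λ (α , _) (β , β′) (γ , γ′) →
          cong (_, β′) (cancel′ (θ γ′) (α ⁻¹) γ β)
      ; ▷-⟵-▷ = λ _ _ _ → refl
      ; ▷-◁-▷ = λ (α , _) (β , β′) (γ , γ′) →
          cong (_, β′) (cancel (θ γ′ ★ (γ ⁻¹)) α β)
      ; ▷-⟶-▷ = λ _ _ _ → refl
      ; ▷-▷-▷ = λ (α , α′) (β , β′) (γ , γ′) →
          cong (_, α′) (cancel′ (θ β′) (θ γ′ ★ (γ ⁻¹)) β α)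
      }
    }

{-# OPTIONS --safe #-}

-- When ⟵ and ⟶ are the projections, the translations L α = α ◁_ satisfy
-- L (α ◁ β) = L β ∘ (L α)⁻¹, so they form a group acting freely on Ω, and α ◁ α is the
-- unique point of the orbit of α that acts trivially.  Hence α is determined by its
-- translation and by α ◁ α.  The group of translations is realised inside Ω as the set of
-- those α with α ◁ α = e for a fixed idempotent e, where α⁻¹ ★ β = α ◁ β; K is the set of
-- idempotents of ◁.  The maps _▷ β are translations too, and θ k represents _▷ k.
module Submission where

open import Algebra.Core using (Op₁; Op₂)
open import Algebra.Structures using (IsGroup)
import Axiom.UniquenessOfIdentityProofs as UIP
open import Data.Fin.Properties using (inj⇒≟)
open import Data.Product using (Σ; ∃; _×_; _,_; proj₁; proj₂)
open import Function.Definitions using (Bijective)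
open import Function.Properties.Inverse using (↔⇒↣)
open import Relation.Binary.Definitions using (DecidableEquality)
open import Relation.Binary.PropositionalEquality
  using (_≡_; refl; sym; trans; cong; cong₂; isEquivalence; module ≡-Reasoning)
open import Defs

open ≡-Reasoning

-- Finiteness serves to decide equality, which makes membership proofs in `H` and `K` unique.
Finite⇒≟ : ∀ {a} {A : Set a} → Finite A → DecidableEquality A
Finite⇒≟ (_ , A↔Fin) = inj⇒≟ (↔⇒↣ A↔Fin)

-- Translations by `◁` and their inverses.

module LeftTranslations {a} {Ω : Set a} (_◁_ : Op₂ Ω)
  (◁-cancel : ∀ α β γ → (α ◁ β) ◁ (α ◁ γ) ≡ β ◁ γ)
  (◁-surjective : ∀ α γ → ∃ λ β → α ◁ β ≡ γ)
  where

  Idempotent : Ω → Set a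
  Idempotent e = e ◁ e ≡ e

  square-idempotent : ∀ α → Idempotent (α ◁ α)
  square-idempotent α = ◁-cancel α α α

  -- Surjectivity of `α ◁_` writes `γ` as `α ◁ β`, and `◁-cancel` applies.
  square-◁ : ∀ α γ → (α ◁ α) ◁ γ ≡ γ
  square-◁ α γ with β , refl ← ◁-surjective α γ = ◁-cancel α α β

  idempotent-◁ : ∀ {e} → Idempotent e → ∀ γ → e ◁ γ ≡ γ
  idempotent-◁ {e} ee γ = trans (cong (_◁ γ) (sym ee)) (square-◁ e γ)

  ◁-inverseˡ : ∀ {e} → Idempotent e → ∀ α γ → (α ◁ e) ◁ (α ◁ γ) ≡ γ
  ◁-inverseˡ {e} ee α γ = trans (◁-cancel α e γ) (idempotent-◁ ee γ)

  ◁-inverseʳ : ∀ {e} → Idempotent e → ∀ α γ → α ◁ ((α ◁ e) ◁ γ) ≡ γ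
  ◁-inverseʳ {e} ee α γ = begin
    -- Writing the left `α` as `(α ◁ e) ◁ (α ◁ α)` exposes the common factor `α ◁ e` that `◁-cancel`
    -- removes.
    α ◁ ((α ◁ e) ◁ γ)                        ≡⟨ cong (_◁ ((α ◁ e) ◁ γ)) (◁-inverseˡ ee α α) ⟨
    ((α ◁ e) ◁ (α ◁ α)) ◁ ((α ◁ e) ◁ γ)      ≡⟨ ◁-cancel (α ◁ e) (α ◁ α) γ ⟩
    (α ◁ α) ◁ γ                              ≡⟨ square-◁ α γ ⟩
    γ                                        ∎

  ◁-◁ : ∀ {e} → Idempotent e → ∀ α β γ → (α ◁ β) ◁ γ ≡ β ◁ ((α ◁ e) ◁ γ)
  ◁-◁ {e} ee α β γ = begin
    (α ◁ β) ◁ γ                    ≡⟨ cong ((α ◁ β) ◁_) (◁-inverseʳ ee α γ) ⟨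
    (α ◁ β) ◁ (α ◁ ((α ◁ e) ◁ γ))  ≡⟨ ◁-cancel α β ((α ◁ e) ◁ γ) ⟩
    β ◁ ((α ◁ e) ◁ γ)              ∎

  -- For idempotent `e` this is the orbit of `e` under the translations.
  Above : Ω → Ω → Set a
  Above e α = α ◁ α ≡ e

  above-◁ : ∀ {e} α {β} → Above e β → Above e (α ◁ β)
  above-◁ α {β} βe = trans (◁-cancel α β β) βe

  -- The group on the orbit of an idempotent.

  module At {e} (ee : Idempotent e) where

    infixl 7 _★_
    infix  8 _⁻¹

    _⁻¹ : Op₁ Ω
    α ⁻¹ = α ◁ e

    -- Defined on all of `Ω`, so that `η ★ κ` also makes sense for `κ` in another orbit.
    _★_ : Op₂ Ω
    α ★ β = (α ⁻¹) ◁ β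

    -- Only the actions agree: `α ⁻¹ ⁻¹` is above `e`, while `α` need not be.
    ⁻¹-⁻¹-◁ : ∀ α γ → (α ⁻¹ ⁻¹) ◁ γ ≡ α ◁ γ
    ⁻¹-⁻¹-◁ α γ = begin
      (α ⁻¹ ⁻¹) ◁ γ                     ≡⟨ ◁-◁ ee (α ⁻¹) e γ ⟩
      e ◁ ((α ⁻¹ ⁻¹) ◁ γ)               ≡⟨ idempotent-◁ ee _ ⟩
      (α ⁻¹ ⁻¹) ◁ γ                     ≡⟨ cong ((α ⁻¹ ⁻¹) ◁_) (◁-inverseˡ ee α γ) ⟨
      (α ⁻¹ ⁻¹) ◁ ((α ⁻¹) ◁ (α ◁ γ))    ≡⟨ ◁-inverseˡ ee (α ⁻¹) (α ◁ γ) ⟩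
      α ◁ γ                             ∎

    ★-◁ : ∀ α β γ → (α ★ β) ◁ γ ≡ β ◁ (α ◁ γ)
    ★-◁ α β γ = trans (◁-◁ ee (α ⁻¹) β γ) (cong (β ◁_) (⁻¹-⁻¹-◁ α γ))

    ★-assoc : ∀ α β γ → (α ★ β) ★ γ ≡ α ★ (β ★ γ)
    ★-assoc α β γ = begin
      ((α ★ β) ⁻¹) ◁ γ          ≡⟨ cong (_◁ γ) (★-◁ α β e) ⟩
      (β ◁ (α ⁻¹)) ◁ γ          ≡⟨ ◁-◁ ee β (α ⁻¹) γ ⟩
      (α ⁻¹) ◁ ((β ⁻¹) ◁ γ)     ∎

    ★-identityˡ : ∀ α → e ★ α ≡ α
    ★-identityˡ α = square-◁ e α

    ★-identityʳ : ∀ {α} → Above e α → α ★ e ≡ α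
    ★-identityʳ {α} αe = trans (cong ((α ⁻¹) ◁_) (sym αe)) (◁-inverseˡ ee α α)

    ★-inverseˡ : ∀ {α} → Above e α → α ⁻¹ ★ α ≡ e
    ★-inverseˡ {α} αe = trans (⁻¹-⁻¹-◁ α α) αe

    ★-inverseʳ : ∀ α → α ★ α ⁻¹ ≡ e
    ★-inverseʳ α = above-◁ α ee

    above-injective : ∀ {α β} → Above e α → Above e β → α ⁻¹ ≡ β ⁻¹ → α ≡ β
    above-injective {α} {β} αe βe eq = begin
      α      ≡⟨ ★-identityʳ αe ⟨
      α ★ e  ≡⟨ cong (_◁ e) eq ⟩
      β ★ e  ≡⟨ ★-identityʳ βe ⟩
      β      ∎

    -- A double inverse, first at the idempotent `α ◁ α` and then at `e`: it carries `α` into the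
    -- orbit of `e` and keeps its action.
    translation : Op₁ Ω
    translation α = (α ◁ (α ◁ α)) ◁ e

    translation-above : ∀ α → Above e (translation α)
    translation-above α = above-◁ (α ◁ (α ◁ α)) ee

    translation-◁ : ∀ α γ → translation α ◁ γ ≡ α ◁ γ
    translation-◁ α γ = begin
      translation α ◁ γ
        ≡⟨ cong (translation α ◁_) (◁-inverseˡ (square-idempotent α) α γ) ⟨
      translation α ◁ ((α ◁ (α ◁ α)) ◁ (α ◁ γ))
        ≡⟨ ◁-inverseˡ ee (α ◁ (α ◁ α)) (α ◁ γ) ⟩
      α ◁ γ
        ∎

    translation-★-square : ∀ α → translation α ★ (α ◁ α) ≡ α
    translation-★-square α = trans (cong (_◁ (α ◁ α)) (translation-◁ α e)) (◁-inverseˡ ee α α)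

    square-★ : ∀ η {κ} → Idempotent κ → (η ★ κ) ◁ (η ★ κ) ≡ κ
    square-★ η κκ = above-◁ (η ⁻¹) κκ

    -- Since `_⁻¹` evaluates the action at `e` and the action is free, agreement at that single
    -- point suffices.
    translation-unique : ∀ {η} → Above e η → ∀ α → η ⁻¹ ≡ α ⁻¹ → translation α ≡ η
    translation-unique ηe α eq =
      above-injective (translation-above α) ηe (trans (translation-◁ α e) (sym eq))

    translation-★ : ∀ {η κ} → Above e η → Idempotent κ → translation (η ★ κ) ≡ η
    translation-★ {η} {κ} ηe κκ = translation-unique ηe (η ★ κ) (begin
      η ⁻¹          ≡⟨ idempotent-◁ κκ (η ⁻¹) ⟨
      κ ◁ (η ⁻¹)    ≡⟨ ★-◁ η κ e ⟨
      (η ★ κ) ⁻¹    ∎)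

    translation-homo : ∀ α β → translation (α ◁ β) ≡ translation α ⁻¹ ★ translation β
    translation-homo α β = translation-unique (above-◁ _ (translation-above β)) (α ◁ β) (begin
      (translation α ⁻¹ ★ translation β) ⁻¹
        ≡⟨ cong _⁻¹ (⁻¹-⁻¹-◁ (translation α) (translation β)) ⟩
      (translation α ◁ translation β) ⁻¹
        ≡⟨ cong _⁻¹ (translation-◁ α (translation β)) ⟩
      (α ◁ translation β) ⁻¹
        ≡⟨ ◁-◁ ee α (translation β) e ⟩
      translation β ◁ ((α ◁ e) ◁ e)
        ≡⟨ translation-◁ β ((α ◁ e) ◁ e) ⟩
      β ◁ ((α ◁ e) ◁ e)
        ≡⟨ ◁-◁ ee α β e ⟨
      (α ◁ β) ⁻¹
        ∎)

    -- The operation `▷` in terms of the group.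

    module RightTranslations (_▷_ : Op₂ Ω)
      (◁-▷ : ∀ α β γ → (α ◁ β) ▷ (α ◁ γ) ≡ β ▷ γ)
      (▷-◁ : ∀ α β γ → (α ▷ γ) ◁ (β ▷ γ) ≡ α ◁ β)
      (▷-surjective : ∀ β γ → ∃ λ α → α ▷ β ≡ γ)
      where

      -- By freeness the translation `_▷ κ` is determined by its value at `e`.
      θ : Op₁ Ω
      θ κ = e ▷ κ

      θ-above : ∀ κ → Above e (θ κ)
      θ-above κ = trans (▷-◁ e e κ) ee

      ▷-square : ∀ α β → (α ▷ β) ◁ (α ▷ β) ≡ α ◁ α
      ▷-square α β = ▷-◁ α α β

      -- Acting by `β` on both arguments of `δ ▷ β` turns the right one into `β ◁ β`, so that `▷-◁`
      -- can cancel it against `θ (β ◁ β)`.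
      θ-square-◁ : ∀ β δ → θ (β ◁ β) ◁ (δ ▷ β) ≡ β ◁ δ
      θ-square-◁ β δ = begin
        θ (β ◁ β) ◁ (δ ▷ β)               ≡⟨ cong (θ (β ◁ β) ◁_) (◁-▷ β δ β) ⟨
        θ (β ◁ β) ◁ ((β ◁ δ) ▷ (β ◁ β))   ≡⟨ ▷-◁ e (β ◁ δ) (β ◁ β) ⟩
        e ◁ (β ◁ δ)                       ≡⟨ idempotent-◁ ee (β ◁ δ) ⟩
        β ◁ δ                             ∎

      -- The identity to prove says that θ (β ◁ β) acts as (L β) ∘ (_▷ β)⁻¹; it is tested at
      -- the point e = δ ▷ β.
      translation-▷ : ∀ α β →
        translation (α ▷ β) ≡ (θ (β ◁ β) ★ translation β ⁻¹) ★ translation α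
      translation-▷ α β with δ , δ▷β≡e ← ▷-surjective β e =
        translation-unique (above-◁ _ (translation-above α)) (α ▷ β) (begin
          ((θ (β ◁ β) ★ τβ ⁻¹) ★ translation α) ⁻¹
            ≡⟨ ★-◁ (θ (β ◁ β) ★ τβ ⁻¹) (translation α) e ⟩
          translation α ◁ ((θ (β ◁ β) ★ τβ ⁻¹) ◁ e)
            ≡⟨ translation-◁ α ((θ (β ◁ β) ★ τβ ⁻¹) ◁ e) ⟩
          α ◁ ((θ (β ◁ β) ★ τβ ⁻¹) ◁ e)
            ≡⟨ cong (α ◁_) (★-◁ (θ (β ◁ β)) (τβ ⁻¹) e) ⟩
          α ◁ ((τβ ⁻¹) ◁ (θ (β ◁ β) ◁ e))
            ≡⟨ cong (λ γ → α ◁ ((τβ ⁻¹) ◁ (θ (β ◁ β) ◁ γ))) δ▷β≡e ⟨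
          α ◁ ((τβ ⁻¹) ◁ (θ (β ◁ β) ◁ (δ ▷ β)))
            ≡⟨ cong (λ γ → α ◁ ((τβ ⁻¹) ◁ γ)) (θ-square-◁ β δ) ⟩
          α ◁ ((τβ ⁻¹) ◁ (β ◁ δ))
            ≡⟨ cong (λ γ → α ◁ (γ ◁ (β ◁ δ))) (translation-◁ β e) ⟩
          α ◁ ((β ⁻¹) ◁ (β ◁ δ))
            ≡⟨ cong (α ◁_) (◁-inverseˡ ee β δ) ⟩
          α ◁ δ
            ≡⟨ ▷-◁ α δ β ⟨
          (α ▷ β) ◁ (δ ▷ β)
            ≡⟨ cong ((α ▷ β) ◁_) δ▷β≡e ⟩
          (α ▷ β) ⁻¹
            ∎)
        where
        τβ : Ω
        τβ = translation β

-- The isomorphism onto `EDS*`.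

module Classification {a} (E : EDS a)
  (_≟_ : DecidableEquality (EDS.Carrier E))
  (ω : EDS.Carrier E)
  (nondegenerate : Nondegenerate E)
  (⟵-proj : ∀ α β → EDS._⟵_ E α β ≡ α)
  (⟶-proj : ∀ α β → EDS._⟶_ E α β ≡ β)
  where

  open EDS E

  ◁-cancel : ∀ α β γ → (α ◁ β) ◁ (α ◁ γ) ≡ β ◁ γ
  ◁-cancel α β γ = trans (cong (λ x → (α ◁ β) ◁ (x ◁ γ)) (sym (⟵-proj α β))) (◁-◁-◁ α β γ)

  ◁-▷ : ∀ α β γ → (α ◁ β) ▷ (α ◁ γ) ≡ β ▷ γ
  ◁-▷ α β γ = trans (cong (λ x → (α ◁ β) ▷ (x ◁ γ)) (sym (⟵-proj α β))) (◁-▷-◁ α β γ)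

  ▷-◁ : ∀ α β γ → (α ▷ γ) ◁ (β ▷ γ) ≡ α ◁ β
  ▷-◁ α β γ = trans (cong (λ x → (α ▷ x) ◁ (β ▷ γ)) (sym (⟶-proj β γ))) (▷-◁-▷ α β γ)

  -- As `⟵` is the first projection, a preimage of `(α , γ)` under `φ⟵` has first component `α`; its
  -- second component is the witness.
  ◁-surjective : ∀ α γ → ∃ λ β → α ◁ β ≡ γ
  ◁-surjective α γ with (α′ , β) , φ≡ ← proj₂ (proj₁ nondegenerate) (α , γ) =
    β , trans (cong (_◁ β) (trans (sym (cong proj₁ (φ≡ refl))) (⟵-proj α′ β)))
              (cong proj₂ (φ≡ refl))

  ▷-surjective : ∀ β γ → ∃ λ α → α ▷ β ≡ γ
  ▷-surjective β γ with (α , β′) , φ≡ ← proj₂ (proj₂ nondegenerate) (β , γ) =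
    α , trans (cong (α ▷_) (trans (sym (cong proj₁ (φ≡ refl))) (⟶-proj α β′)))
              (cong proj₂ (φ≡ refl))

  open LeftTranslations _◁_ ◁-cancel ◁-surjective

  -- Nonemptiness supplies this base point, which is the unit of `H` and also shows that `K` is
  -- nonempty.
  e : Carrier
  e = ω ◁ ω

  open At (square-idempotent ω)
  open RightTranslations _▷_ ◁-▷ ▷-◁ ▷-surjective

  H : Set a
  H = Σ Carrier (Above e)

  K : Set a
  K = Σ Carrier Idempotent

  -- Decidability of equality on Ω makes H and K genuine subsets.
  subset-≡ : {f g : Carrier → Carrier} {x y : Σ Carrier λ α → f α ≡ g α} →
    proj₁ x ≡ proj₁ y → x ≡ y
  subset-≡ refl = cong (_ ,_) (UIP.Decidable⇒UIP.≡-irrelevant _≟_ _ _)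

  H-≡ : {x y : H} → proj₁ x ≡ proj₁ y → x ≡ y
  H-≡ = subset-≡ {f = λ α → α ◁ α} {g = λ _ → e}

  K-≡ : {x y : K} → proj₁ x ≡ proj₁ y → x ≡ y
  K-≡ = subset-≡ {f = λ α → α ◁ α} {g = λ α → α}

  εᴴ : H
  εᴴ = e , square-idempotent ω

  _★ᴴ_ : Op₂ H
  (α , αe) ★ᴴ (β , βe) = α ★ β , above-◁ (α ⁻¹) βe

  _⁻¹ᴴ : Op₁ H
  (α , αe) ⁻¹ᴴ = α ⁻¹ , above-◁ α (square-idempotent ω)

  isGroup : IsGroup _≡_ _★ᴴ_ εᴴ _⁻¹ᴴ
  isGroup = record
    { isMonoid = record
      { isSemigroup = record
        { isMagma = record { isEquivalence = isEquivalence ; ∙-cong = cong₂ _★ᴴ_ }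
        ; assoc   = λ (α , _) (β , _) (γ , _) → H-≡ (★-assoc α β γ)
        }
      ; identity = (λ (α , _) → H-≡ (★-identityˡ α)) , (λ (_ , αe) → H-≡ (★-identityʳ αe))
      }
    ; inverse = (λ (_ , αe) → H-≡ (★-inverseˡ αe)) , (λ (α , _) → H-≡ (★-inverseʳ α))
    ; ⁻¹-cong = cong _⁻¹ᴴ
    }

  κ₀ : K
  κ₀ = e , square-idempotent ω

  θᴴ : K → H
  θᴴ (κ , _) = θ κ , θ-above κ

  to : Carrier → H × K
  to α = (translation α , translation-above α) , (α ◁ α , square-idempotent α)

  H×K-≡ : {x y : H × K} → proj₁ (proj₁ x) ≡ proj₁ (proj₁ y) →
    proj₁ (proj₂ x) ≡ proj₁ (proj₂ y) → x ≡ y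
  H×K-≡ p q = cong₂ _,_ (H-≡ p) (K-≡ q)

  -- The point `η ★ κ` lies in the orbit of `κ` and acts as `η`, which makes it the preimage of the
  -- pair.
  from : H × K → Carrier
  from ((η , _) , (κ , _)) = η ★ κ

  to-bijective : Bijective _≡_ _≡_ to
  to-bijective = injective , surjective
    where
    injective : ∀ {α β} → to α ≡ to β → α ≡ β
    injective {α} {β} eq =
      trans (sym (translation-★-square α)) (trans (cong from eq) (translation-★-square β))

    surjective : ∀ y → ∃ λ α → ∀ {β} → β ≡ α → to β ≡ y
    surjective y@((η , ηe) , (κ , κκ)) =
      from y , λ { refl → H×K-≡ (translation-★ ηe κκ) (square-★ η κκ) }

  iso : E ≅ EDS* isGroup θᴴ
  iso = record
    { to        = to
    ; bijective = to-bijective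
    ; ⟵-homo    = λ α β → cong to (⟵-proj α β)
    ; ⟶-homo    = λ α β → cong to (⟶-proj α β)
    ; ◁-homo    = λ α β → H×K-≡ (translation-homo α β) (◁-cancel α β β)
    ; ▷-homo    = λ α β → H×K-≡ (translation-▷ α β) (▷-square α β)
    }

proposition10 : ∀ {a} (Ω : EDS a) →
    let
      open EDS Ω
    in
    Finite Carrier →
    Carrier →
    Nondegenerate Ω →
    (∀ α β → α ⟵ β ≡ α) →
    (∀ α β → α ⟶ β ≡ β) →
    Σ (Set a) λ H →
    Σ (Op₂ H) λ _★_ →
    Σ H λ ε →
    Σ (Op₁ H) λ _⁻¹ →
    Σ (IsGroup _≡_ _★_ ε _⁻¹) λ isGroup →
    Σ (Set a) λ K →
    K ×
    Σ (K → H) λ θ →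
      Ω ≅ EDS* isGroup θ
proposition10 Ω finite ω nondegenerate ⟵-proj ⟶-proj =
  C.H , C._★ᴴ_ , C.εᴴ , C._⁻¹ᴴ , C.isGroup , C.K , C.κ₀ , C.θᴴ , C.iso
  where
  module C = Classification Ω (Finite⇒≟ finite) ω nondegenerate ⟵-proj ⟶-proj
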